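{- For all $t\in\mathbb{N}$ such that $t\ge 3$, $$gr^t_2(B_4)=\begin{cases} 7 & \text{if } t=3, \\ 8 & \text{if } t\ge 4.\end{cases}$$
   Context: $K_n$ is the complete graph of order $n$. The book $B_n:=K_2+nK_1$ (graph join) is the graph on $n+2$ vertices consisting of an edge $xy$ (the spine) together with $n$ further, pairwise non-adjacent vertices (the pages), each adjacent to both $x$ and $y$. A $t$-coloring of $K_p$ is a map $f:E(K_p)\to\{1,\dots,t\}$, not assumed surjective. A Gallai $t$-coloring is a $t$-coloring with no rainbow triangle, i.e. there are no three vertices $x,y,z$ such that $f(xy),f(xz),f(yz)$ are pairwise distinct. For $1\le s<t$ and a graph $G$, the weakened Gallai-Ramsey number $gr^t_s(G)$ is the least $p\in\mathbb{N}$ such that every Gallai $t$-coloring of $K_p$ contains a (not necessarily induced) subgraph isomorphic to $G$ whose edges use at most $s$ colors. -}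

module Defs where

open import Data.Empty using (⊥)
open import Data.Fin using (Fin)
open import Data.Fin.Subset using (Subset; _∈_; ∣_∣)
open import Data.Nat using (ℕ; _≤_)
open import Data.Product using (Σ-syntax; ∃-syntax; _×_; _,_)
open import Data.Sum using (_⊎_; inj₁; inj₂)
open import Data.Unit using (⊤; tt)
open import Function.Definitions using (Injective)
open import Relation.Binary.Definitions using (Symmetric; Irreflexive)
open import Relation.Binary.PropositionalEquality using (_≡_; _≢_; refl; sym; ≢-sym)
open import Relation.Nullary using (¬_)

record Graph : Set₁ where
  field
    Vertex      : Set
    Adj         : Vertex → Vertex → Set
    symmetric   : Symmetric Adj
    irreflexive : Irreflexive _≡_ Adj

open Graph public

K : ℕ → Graph
K n = record
  { Vertex      = Fin n
  ; Adj         = _≢_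
  ; symmetric   = ≢-sym
  ; irreflexive = λ u≡v u≢v → u≢v u≡v
  }

-- The disjoint union of n copies of G, written nG in the literature.
copies : ℕ → Graph → Graph
copies n G = record
  { Vertex      = Fin n × Vertex G
  ; Adj         = λ (i , u) (j , v) → i ≡ j × Adj G u v
  ; symmetric   = λ (i≡j , uv) → sym i≡j , symmetric G uv
  ; irreflexive = λ { refl (_ , uu) → irreflexive G refl uu }
  }

JoinAdj : (G H : Graph) → Vertex G ⊎ Vertex H → Vertex G ⊎ Vertex H → Set
JoinAdj G H (inj₁ u) (inj₁ v) = Adj G u v
JoinAdj G H (inj₁ _) (inj₂ _) = ⊤
JoinAdj G H (inj₂ _) (inj₁ _) = ⊤
JoinAdj G H (inj₂ u) (inj₂ v) = Adj H u v

join : Graph → Graph → Graph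
join G H = record
  { Vertex      = Vertex G ⊎ Vertex H
  ; Adj         = JoinAdj G H
  ; symmetric   = λ {u} {v} → joinSym u v
  ; irreflexive = λ {u} {v} → joinIrrefl u v
  }
  where
  joinSym : ∀ u v → JoinAdj G H u v → JoinAdj G H v u
  joinSym (inj₁ _) (inj₁ _) uv = symmetric G uv
  joinSym (inj₁ _) (inj₂ _) _  = tt
  joinSym (inj₂ _) (inj₁ _) _  = tt
  joinSym (inj₂ _) (inj₂ _) uv = symmetric H uv

  joinIrrefl : ∀ u v → u ≡ v → JoinAdj G H u v → ⊥
  joinIrrefl (inj₁ _) _ refl uu = irreflexive G refl uu
  joinIrrefl (inj₂ _) _ refl uu = irreflexive H refl uu

Book : ℕ → Graph
Book n = join (K 2) (copies n (K 1))

-- A copy of G as a (not necessarily induced) subgraph of H.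
record Copy (G H : Graph) : Set where
  field
    map       : Vertex G → Vertex H
    injective : Injective _≡_ _≡_ map
    preserves : ∀ {u v} → Adj G u v → Adj H (map u) (map v)

open Copy public

-- A t-colouring of the edges of K p: colour u v is the colour of the edge uv
-- when u ≢ v. The values colour u u carry no meaning, and nothing below
-- depends on them.
record Colouring (p t : ℕ) : Set where
  field
    colour     : Fin p → Fin p → Fin t
    colour-sym : ∀ u v → colour u v ≡ colour v u

open Colouring public

RainbowTriangle : ∀ {p t} → Colouring p t → Set
RainbowTriangle f = ∃[ x ] ∃[ y ] ∃[ z ]
  (x ≢ y × x ≢ z × y ≢ z)
  × (colour f x y ≢ colour f x z
     × colour f x y ≢ colour f y z
     × colour f x z ≢ colour f y z)

Gallai : ∀ {p t} → Colouring p t → Set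
Gallai f = ¬ RainbowTriangle f

UsesAtMost : ∀ {p t G} → ℕ → Colouring p t → Copy G (K p) → Set
UsesAtMost {t = t} {G = G} s f φ = Σ[ S ∈ Subset t ]
  ∣ S ∣ ≤ s × (∀ {u v} → Adj G u v → colour f (map φ u) (map φ v) ∈ S)

Forces : (t s : ℕ) → Graph → ℕ → Set
Forces t s G p = (f : Colouring p t) → Gallai f →
  Σ[ φ ∈ Copy G (K p) ] UsesAtMost s f φ

-- The weakened Gallai–Ramsey number gr^t_s(G), meant for 1 ≤ s < t, is p.
-- A relation, so that no existence proof is needed to state its value.
IsGR : (t s : ℕ) → Graph → ℕ → Set
IsGR t s G p = Forces t s G p × (∀ q → Forces t s G q → p ≤ q)

-- Lower bounds: two triangles coloured 1, 1, 2 and 2, 2, 1 and joined completely in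
-- colour 0 form a Gallai 3-colouring of K₆ without a 2-coloured B₄; a further vertex
-- joined to all others in a fourth colour gives one of K₇.
--
-- Upper bounds: extend partial colourings edge by edge, naming the colours in order of
-- appearance, until a rainbow triangle or a 2-coloured B₄ is unavoidable. To keep the
-- search small, a first search shows that every Gallai colouring of K₆ contains a
-- monochromatic K₁,₃, so that after relabelling the vertices the search for B₄ may
-- start from such a star. Incomplete pages count too: in a Gallai colouring an edge of
-- colour b joining w to one end of a spine of colour a ≠ b forces the edge from w to
-- the other end into {a , b}.

module Submission where

open import Defs
open import Data.Bool using (Bool; true; false; T; not; _∧_; _∨_; if_then_else_)
open import Data.Bool.ListAction using (all; any)
open import Data.Bool.Properties using (T-∧; T-∨; T-≡; T-not-≡)
open import Data.Empty using (⊥-elim)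
open import Data.Fin using (Fin; zero; suc; #_; _↑ˡ_; _↑ʳ_; inject≤; _≟_)
open import Data.Fin.Properties
  using (any?; all?; toℕ<n; toℕ-injective; ↑ʳ-injective; inject≤-injective;
         injective⇒≤; ¬∀⟶∃¬; suc-injective; 0≢1+n)
open import Data.Fin.Subset using (Subset; _∈_; ∣_∣; ⁅_⁆; _∪_; inside; outside)
open import Data.Fin.Subset.Properties using (x∈⁅x⁆; x∈p∪q⁺; ∣⁅x⁆∣≡1; _∈?_; anySubset?)
open import Data.List as List using (List; []; _∷_; _++_; _∷ʳ_; upTo)
open import Data.List.Relation.Unary.All as All using (All; []; _∷_)
import Data.List.Relation.Unary.All.Properties as All
import Data.List.Relation.Unary.Any as Any
import Data.List.Relation.Unary.Any.Properties as Any
open import Data.Nat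
  using (ℕ; zero; suc; pred; _+_; _<_; _≤_; _≥_; _≡ᵇ_; _<ᵇ_; _≤?_; z≤n; s≤s; z<s)
import Data.Nat.Properties as ℕ
open import Data.Product using (Σ-syntax; ∃-syntax; _×_; _,_; proj₁; proj₂)
open import Data.Sum using (_⊎_; inj₁; inj₂; [_,_]′)
open import Data.Unit using (tt)
open import Data.Vec as Vec using (Vec; []; _∷_; here; there; lookup; replicate; zip; _[_]≔_)
import Data.Vec.Functional as Fun
open import Data.Vec.Properties
  using (lookup-replicate; lookup-zip; lookup∘update; lookup∘update′)
open import Function using (_∘_; id; const; Equivalence)
open import Function.Definitions using (Injective)
open import Relation.Binary.PropositionalEquality
  using (_≡_; _≢_; refl; sym; trans; cong; cong₂; subst; ≢-sym)
open import Relation.Nullary using (¬_; Dec; yes; no; contradiction; ¬?; _×-dec_)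
open import Relation.Nullary.Decidable using (from-yes; from-no)

-- Injections between finite sets and the choice of distinct indices.

∷-injective : ∀ {m n} {g : Fin m → Fin n} {y} → (∀ i → y ≢ g i) →
  Injective _≡_ _≡_ g → Injective _≡_ _≡_ (y Fun.∷ g)
∷-injective y∉g inj {zero}  {zero}  _  = refl
∷-injective y∉g inj {zero}  {suc j} eq = contradiction eq (y∉g j)
∷-injective y∉g inj {suc i} {zero}  eq = contradiction (sym eq) (y∉g i)
∷-injective y∉g inj {suc i} {suc j} eq = cong suc (inj eq)

-- Were `g` onto, a choice of preimages would inject `Fin n` into `Fin m`.
outsideImage : ∀ {m n} (g : Fin m → Fin n) → m < n → ∃[ y ] ∀ i → y ≢ g i
outsideImage {m} {n} g m<n =
  let y , y∉g = ¬∀⟶∃¬ n (λ y → ∃[ i ] y ≡ g i) (λ y → any? (λ i → y ≟ g i)) notOnto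
  in y , λ i y≡gi → y∉g (i , y≡gi)
  where
  notOnto : ¬ (∀ y → ∃[ i ] y ≡ g i)
  notOnto onto = ℕ.<⇒≱ m<n (injective⇒≤ {f = proj₁ ∘ onto}
    λ {x} {y} eq → trans (proj₂ (onto x)) (trans (cong g eq) (sym (proj₂ (onto y)))))

-- New values are put in front one at a time, so `g` ends up on the last `m` indices. For
-- `d + m ≡ n` this relabels all vertices with a prescribed configuration at the end.
extendInjection : ∀ d {m n} (g : Fin m → Fin n) → Injective _≡_ _≡_ g → d + m ≤ n →
  Σ[ σ ∈ (Fin (d + m) → Fin n) ] Injective _≡_ _≡_ σ × (∀ i → σ (d ↑ʳ i) ≡ g i)
extendInjection zero    g inj _ = g , inj , λ _ → refl
extendInjection (suc d) g inj d+m<n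
  with σ , σ-inj , σ-extends ← extendInjection d g inj (ℕ.<⇒≤ d+m<n)
  with y , y∉σ ← outsideImage σ d+m<n
  = y Fun.∷ σ , ∷-injective y∉σ σ-inj , σ-extends

Selection : ∀ {n} → ℕ → (Fin n → Set) → Set
Selection {n} m P = Σ[ g ∈ (Fin m → Fin n) ] Injective _≡_ _≡_ g × (∀ i → P (g i))

atLeast : ∀ {A : Set} {n} → ℕ → (A → Bool) → Vec A n → Bool
atLeast zero    p xs       = true
atLeast (suc m) p []       = false
atLeast (suc m) p (x ∷ xs) = if p x then atLeast m p xs else atLeast (suc m) p xs

select : ∀ {A : Set} {n} m (p : A → Bool) (xs : Vec A n) →
  T (atLeast m p xs) → Selection m (λ i → T (p (lookup xs i)))
select zero    p xs       _ = (λ ()) , (λ {}) , λ ()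
select (suc m) p (x ∷ xs) h with p x in px
... | true with g , inj , holds ← select m p xs h
  = zero Fun.∷ (suc ∘ g)
  , ∷-injective (λ _ ()) (inj ∘ suc-injective)
  , λ { zero → Equivalence.from T-≡ px ; (suc i) → holds i }
... | false with g , inj , holds ← select (suc m) p xs h
  = suc ∘ g , inj ∘ suc-injective , holds

-- Restricting and relabelling colourings.

relabel : ∀ {m n t} → (Fin m → Fin n) → Colouring n t → Colouring m t
relabel σ f = record
  { colour     = λ u v → colour f (σ u) (σ v)
  ; colour-sym = λ u v → colour-sym f (σ u) (σ v)
  }

relabel-Gallai : ∀ {m n t} {σ : Fin m → Fin n} → Injective _≡_ _≡_ σ →
  (f : Colouring n t) → Gallai f → Gallai (relabel σ f)
relabel-Gallai {σ = σ} inj f gallai (x , y , z , (xy , xz , yz) , rainbow) =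
  gallai (σ x , σ y , σ z , (xy ∘ inj , xz ∘ inj , yz ∘ inj) , rainbow)

CopyUsing : ∀ {n t} → ℕ → Graph → Colouring n t → Set
CopyUsing {n} s G f = Σ[ φ ∈ Copy G (K n) ] UsesAtMost s f φ

relabel-copy : ∀ {m n t s G} {σ : Fin m → Fin n} → Injective _≡_ _≡_ σ →
  (f : Colouring n t) → CopyUsing s G (relabel σ f) → CopyUsing s G f
relabel-copy {σ = σ} inj f (φ , S , S≤s , uses) =
  record
    { map       = σ ∘ map φ
    ; injective = injective φ ∘ inj
    ; preserves = λ uv → preserves φ uv ∘ inj
    }
  , S , S≤s , uses

Forces-mono : ∀ {t s G m n} → m ≤ n → Forces t s G m → Forces t s G n
Forces-mono m≤n forces f gallai =
  relabel-copy inj f (forces (relabel _ f) (relabel-Gallai inj f gallai))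
  where
  inj : Injective _≡_ _≡_ (λ i → inject≤ i m≤n)
  inj = inject≤-injective m≤n m≤n _ _

-- Two-coloured books from a spine and its pages.

∣p∪q∣≤∣p∣+∣q∣ : ∀ {n} (p q : Subset n) → ∣ p ∪ q ∣ ≤ ∣ p ∣ + ∣ q ∣
∣p∪q∣≤∣p∣+∣q∣ []            []            = z≤n
∣p∪q∣≤∣p∣+∣q∣ (inside  ∷ p) (outside ∷ q) = s≤s (∣p∪q∣≤∣p∣+∣q∣ p q)
∣p∪q∣≤∣p∣+∣q∣ (outside ∷ p) (outside ∷ q) = ∣p∪q∣≤∣p∣+∣q∣ p q
∣p∪q∣≤∣p∣+∣q∣ (inside  ∷ p) (inside  ∷ q) =
  s≤s (ℕ.≤-trans (∣p∪q∣≤∣p∣+∣q∣ p q) (ℕ.+-monoʳ-≤ ∣ p ∣ (ℕ.n≤1+n ∣ q ∣)))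
∣p∪q∣≤∣p∣+∣q∣ (outside ∷ p) (inside  ∷ q) =
  ℕ.≤-trans (s≤s (∣p∪q∣≤∣p∣+∣q∣ p q)) (ℕ.≤-reflexive (sym (ℕ.+-suc ∣ p ∣ ∣ q ∣)))

bookCopy : ∀ {m n t} (f : Colouring n t) {u v} (a b : Fin t) → u ≢ v → colour f u v ≡ a →
  Selection m (λ w → (u ≢ w × v ≢ w) × (colour f u w ∈ ⁅ a ⁆ ∪ ⁅ b ⁆ × colour f v w ∈ ⁅ a ⁆ ∪ ⁅ b ⁆)) →
  CopyUsing 2 (Book m) f
bookCopy {m} {n} f {u} {v} a b u≢v uv≡a (g , g-inj , pages) =
  record
    { map       = place
    ; injective = place-inj
    -- Adjacency in `K n` is `_≢_`, so it is enough that adjacent vertices of the book are distinct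
    -- and that `place` is injective.
    ; preserves = λ {x} {y} xy eq → irreflexive (Book m) {x} {y} (place-inj eq) xy
    }
  , S , S≤2 , λ {x} {y} → uses x y
  where
  S = ⁅ a ⁆ ∪ ⁅ b ⁆

  S≤2 : ∣ S ∣ ≤ 2
  S≤2 = ℕ.≤-trans (∣p∪q∣≤∣p∣+∣q∣ ⁅ a ⁆ ⁅ b ⁆) (ℕ.≤-reflexive (cong₂ _+_ (∣⁅x⁆∣≡1 a) (∣⁅x⁆∣≡1 b)))

  place : Vertex (Book m) → Fin n
  place (inj₁ zero)       = u
  place (inj₁ (suc zero)) = v
  place (inj₂ (i , zero)) = g i

  place-inj : Injective _≡_ _≡_ place
  place-inj {inj₁ zero}       {inj₁ zero}       _  = refl
  place-inj {inj₁ zero}       {inj₁ (suc zero)} eq = contradiction eq u≢v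
  place-inj {inj₁ zero}       {inj₂ (i , zero)} eq = contradiction eq (proj₁ (proj₁ (pages i)))
  place-inj {inj₁ (suc zero)} {inj₁ zero}       eq = contradiction (sym eq) u≢v
  place-inj {inj₁ (suc zero)} {inj₁ (suc zero)} _  = refl
  place-inj {inj₁ (suc zero)} {inj₂ (i , zero)} eq = contradiction eq (proj₂ (proj₁ (pages i)))
  place-inj {inj₂ (i , zero)} {inj₁ zero}       eq = contradiction (sym eq) (proj₁ (proj₁ (pages i)))
  place-inj {inj₂ (i , zero)} {inj₁ (suc zero)} eq = contradiction (sym eq) (proj₂ (proj₁ (pages i)))
  place-inj {inj₂ (i , zero)} {inj₂ (j , zero)} eq = cong (λ i → inj₂ (i , zero)) (g-inj eq)

  uv∈S : colour f u v ∈ S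
  uv∈S rewrite uv≡a = x∈p∪q⁺ (inj₁ (x∈⁅x⁆ a))

  flip-∈ : ∀ {x y} → colour f x y ∈ S → colour f y x ∈ S
  flip-∈ {x} {y} = subst (_∈ S) (colour-sym f x y)

  uses : ∀ x y → Adj (Book m) x y → colour f (place x) (place y) ∈ S
  uses (inj₁ zero)       (inj₁ zero)       0≢0       = contradiction refl 0≢0
  uses (inj₁ zero)       (inj₁ (suc zero)) _         = uv∈S
  uses (inj₁ zero)       (inj₂ (i , zero)) _         = proj₁ (proj₂ (pages i))
  uses (inj₁ (suc zero)) (inj₁ zero)       _         = flip-∈ uv∈S
  uses (inj₁ (suc zero)) (inj₁ (suc zero)) 1≢1       = contradiction refl 1≢1
  uses (inj₁ (suc zero)) (inj₂ (i , zero)) _         = proj₂ (proj₂ (pages i))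
  uses (inj₂ (i , zero)) (inj₁ zero)       _         = flip-∈ (proj₁ (proj₂ (pages i)))
  uses (inj₂ (i , zero)) (inj₁ (suc zero)) _         = flip-∈ (proj₂ (proj₂ (pages i)))
  uses (inj₂ (_ , zero)) (inj₂ (_ , zero)) (_ , 0≢0) = contradiction refl 0≢0

-- Monochromatic stars, partial colourings and the search.

Claw : ∀ {n t} → Colouring n t → Set
Claw {n} f = Σ[ g ∈ (Fin 4 → Fin n) ] Injective _≡_ _≡_ g ×
  (∃[ a ] ∀ l → colour f (g zero) (g (suc l)) ≡ a)

-- Entry 0 stands for an edge not yet coloured (and fills the diagonal), entry 1 + m for
-- the m-th colour met, counting from 0.
Matrix : ℕ → Set
Matrix n = Vec (Vec ℕ n) n

row : ∀ {n} → Matrix n → Fin n → Vec ℕ n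
row = lookup

entry : ∀ {n} → Matrix n → Fin n → Fin n → ℕ
entry M u v = lookup (row M u) v

blank : ∀ {n} → Matrix n
blank = replicate _ (replicate _ 0)

paint : ∀ {n} → ℕ → Fin n → Fin n → Matrix n → Matrix n
paint m i j M = M [ i ]≔ (row M i [ j ]≔ suc m) [ j ]≔ (row M j [ i ]≔ suc m)

rainbow : ℕ → ℕ × ℕ → Bool
rainbow (suc a) (suc b , suc c) = not (a ≡ᵇ b) ∧ not (a ≡ᵇ c) ∧ not (b ≡ᵇ c)
rainbow _       _               = false

-- Only triangles containing the edge just painted can have become rainbow.
rainbowAt : ∀ {n} → Matrix n → Fin n → Fin n → Bool
rainbowAt M i j = atLeast 1 (rainbow (entry M i j)) (zip (row M i) (row M j))

-- `p` and `q` are the entries of the edges from a vertex to the two ends of a spine with entry `a`.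
-- One edge with entry `b` is enough; without it both edges have to repeat the spine.
page : ℕ → ℕ → ℕ × ℕ → Bool
page a b (p , q) = (p ≡ᵇ b) ∨ (q ≡ᵇ b) ∨ ((p ≡ᵇ a) ∧ (q ≡ᵇ a))

-- An edge of colour c added at a spine of another colour is a new page only for
-- the colour pair containing c, so only that pair has to be examined again.
bookOn : ∀ {n} → ℕ → ℕ → ℕ → Vec (ℕ × ℕ) n → Bool
bookOn k c zero    rows = false
bookOn k c (suc a) rows =
  any (λ b → not (a ≡ᵇ b) ∧ atLeast 4 (page (suc a) (suc b)) rows)
      (if a ≡ᵇ c then upTo (suc k) else c ∷ [])

-- `r` is the row of one spine end; zipping it with `M` offers each vertex as the other end,
-- together with the entry of the spine.
bookFrom : ∀ {n} → ℕ → ℕ → Matrix n → Vec ℕ n → Bool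
bookFrom k c M r = atLeast 1 (λ (a , s) → bookOn k c a (zip r s)) (zip r M)

clawOn : ∀ {n} → ℕ → Vec ℕ n → Bool
clawOn zero    r = false
clawOn (suc a) r = atLeast 3 (_≡ᵇ suc a) r

Test : ℕ → Set
Test n = ℕ → Matrix n → Fin n → Fin n → Bool

-- Every edge of a book meets the spine, so a book completed by painting `ij` has a spine through
-- `i` or `j`.
bookTest : ∀ {n} → Test n
bookTest k M i j = bookFrom k c M (row M i) ∨ bookFrom k c M (row M j)
  where c = pred (entry M i j)

clawTest : ∀ {n} → Test n
clawTest k M i j = clawOn (entry M i j) (row M i) ∨ clawOn (entry M i j) (row M j)

-- fresh k tells whether a further colour may follow the first k.
mutual
  unavoidable : ∀ {n} → (ℕ → Bool) → Test n → List (Fin n × Fin n) → ℕ → Matrix n → Bool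
  unavoidable fresh test []             k M = false
  unavoidable fresh test ((i , j) ∷ es) k M =
    all (λ m → afterPainting fresh test es i j k (paint m i j M)) (upTo k) ∧
    (not (fresh k) ∨ afterPainting fresh test es i j (suc k) (paint k i j M))

  afterPainting : ∀ {n} → (ℕ → Bool) → Test n → List (Fin n × Fin n) →
    Fin n → Fin n → ℕ → Matrix n → Bool
  afterPainting fresh test es i j k M =
    rainbowAt M i j ∨ test k M i j ∨ unavoidable fresh test es k M

-- Soundness of the search.

≡ᵇ-false⇒≢ : ∀ m n → T (not (m ≡ᵇ n)) → m ≢ n
≡ᵇ-false⇒≢ m n h m≡n = subst T (Equivalence.to T-not-≡ h) (ℕ.≡⇒≡ᵇ m n m≡n)

module _ {n t : ℕ} (f : Colouring n t) (gallai : Gallai f) where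

  -- This is what completes a page of which one edge is known. Distinctness of `y` and `w` comes
  -- from the differing colours.
  thirdSide : ∀ {x y w} → x ≢ y → x ≢ w → colour f x y ≢ colour f x w →
    y ≢ w × (colour f y w ≡ colour f x y ⊎ colour f y w ≡ colour f x w)
  thirdSide {x} {y} {w} x≢y x≢w xy≢xw = y≢w , yw
    where
    y≢w : y ≢ w
    y≢w refl = xy≢xw refl

    yw : colour f y w ≡ colour f x y ⊎ colour f y w ≡ colour f x w
    yw with colour f y w ≟ colour f x y | colour f y w ≟ colour f x w
    ... | yes eq | _      = inj₁ eq
    ... | no _   | yes eq = inj₂ eq
    ... | no ≢xy | no ≢xw =
      ⊥-elim (gallai (x , y , w , (x≢y , x≢w , y≢w) , (xy≢xw , ≢-sym ≢xy , ≢-sym ≢xw)))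

  -- `ρ` translates names into actual colours; its values from `k` on are arbitrary. Only nonzero
  -- entries make a claim, and `u ≢ v` keeps them off the diagonal, where colours carry no meaning.
  record Represents (ρ : ℕ → Fin t) (k : ℕ) (M : Matrix n) : Set where
    field
      distinct : ∀ {l m} → l < k → m < k → ρ l ≡ ρ m → l ≡ m
      known    : ∀ {u v m} → entry M u v ≡ suc m → m < k × u ≢ v × colour f u v ≡ ρ m

  open Represents

  blank-represents : ∀ {ρ k} → (∀ {l m} → l < k → m < k → ρ l ≡ ρ m → l ≡ m) →
    Represents ρ k blank
  blank-represents distinct .distinct = distinct
  blank-represents {ρ} {k} _ .known {u} {v} eq = contradiction (trans (sym entry≡0) eq) λ ()
    where
    entry≡0 : entry (blank {n}) u v ≡ 0
    entry≡0 = trans (cong (λ r → lookup r v) (lookup-replicate u _)) (lookup-replicate v 0)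

  paint-represents : ∀ {ρ k M m i j} → i ≢ j → m < k → colour f i j ≡ ρ m →
    Represents ρ k M → Represents ρ k (paint m i j M)
  paint-represents i≢j m<k ij≡ρm R .distinct = R .distinct
  -- The update of row `j` is the outer one, so `u ≟ j` is decided before `u ≟ i`.
  paint-represents {ρ} {k} {M} {m} {i} {j} i≢j m<k ij≡ρm R .known {u} {v} {l} eq with u ≟ j
  ... | yes refl rewrite lookup∘update j (M [ i ]≔ (row M i [ j ]≔ suc m)) (row M j [ i ]≔ suc m)
    with v ≟ i
  ...   | no v≢i rewrite lookup∘update′ v≢i (row M j) (suc m) = R .known eq
  ...   | yes refl rewrite lookup∘update i (row M j) (suc m) | sym (ℕ.suc-injective eq) =
    m<k , ≢-sym i≢j , trans (colour-sym f j i) ij≡ρm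
  paint-represents {ρ} {k} {M} {m} {i} {j} i≢j m<k ij≡ρm R .known {u} {v} {l} eq | no u≢j
    rewrite lookup∘update′ u≢j (M [ i ]≔ (row M i [ j ]≔ suc m)) (row M j [ i ]≔ suc m)
    with u ≟ i
  ... | no u≢i rewrite lookup∘update′ u≢i M (row M i [ j ]≔ suc m) = R .known eq
  ... | yes refl rewrite lookup∘update i M (row M i [ j ]≔ suc m) with v ≟ j
  ...   | no v≢j rewrite lookup∘update′ v≢j (row M i) (suc m) = R .known eq
  ...   | yes refl rewrite lookup∘update j (row M i) (suc m) | sym (ℕ.suc-injective eq) =
    m<k , i≢j , ij≡ρm

  _[_↦_] : (ℕ → Fin t) → ℕ → Fin t → ℕ → Fin t
  (ρ [ k ↦ c ]) m with m ℕ.≟ k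
  ... | yes _ = c
  ... | no  _ = ρ m

  ↦-at : ∀ ρ k c → (ρ [ k ↦ c ]) k ≡ c
  ↦-at ρ k c with k ℕ.≟ k
  ... | yes _  = refl
  ... | no k≢k = contradiction refl k≢k

  ↦-below : ∀ ρ {k m} c → m < k → (ρ [ k ↦ c ]) m ≡ ρ m
  ↦-below ρ {k} {m} c m<k with m ℕ.≟ k
  ... | yes refl = contradiction m<k (ℕ.<-irrefl refl)
  ... | no _     = refl

  name-colour : ∀ {ρ k M} c → (∀ {m} → m < k → ρ m ≢ c) →
    Represents ρ k M → Represents (ρ [ k ↦ c ]) (suc k) M
  name-colour {ρ} {k} c new R .distinct {l} {m} l≤k m≤k eq
    with ℕ.m≤n⇒m<n∨m≡n (ℕ.≤-pred l≤k) | ℕ.m≤n⇒m<n∨m≡n (ℕ.≤-pred m≤k)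
  ... | inj₁ l<k  | inj₁ m<k  =
    R .distinct l<k m<k (trans (sym (↦-below ρ c l<k)) (trans eq (↦-below ρ c m<k)))
  ... | inj₁ l<k  | inj₂ refl =
    contradiction (trans (sym (↦-below ρ c l<k)) (trans eq (↦-at ρ k c))) (new l<k)
  ... | inj₂ refl | inj₁ m<k  =
    contradiction (trans (sym (↦-below ρ c m<k)) (trans (sym eq) (↦-at ρ k c))) (new m<k)
  ... | inj₂ refl | inj₂ refl = refl
  name-colour {ρ} c new R .known eq with m<k , u≢v , uv≡ρm ← R .known eq =
    ℕ.m<n⇒m<1+n m<k , u≢v , trans uv≡ρm (sym (↦-below ρ c m<k))

  -- `ρ` injects the `k` names into the `t` colours. This justifies cutting off the branch of a new
  -- colour when the palette is exhausted.
  represents-≤ : ∀ {ρ k M} → Represents ρ k M → k ≤ t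
  represents-≤ R = injective⇒≤ λ {i} {j} eq → toℕ-injective (R .distinct (toℕ<n i) (toℕ<n j) eq)

  module _ {ρ k M} (R : Represents ρ k M) where

    differ : ∀ {l m} → l < k → m < k → l ≢ m → ρ l ≢ ρ m
    differ l<k m<k l≢m eq = l≢m (R .distinct l<k m<k eq)

    -- The entries are variables tied down by equations, so that matching on them lets `rainbow`
    -- reduce.
    rainbow-sound : ∀ {i j w} a b c → entry M i j ≡ a → entry M i w ≡ b → entry M j w ≡ c →
      ¬ T (rainbow a (b , c))
    rainbow-sound {i} {j} {w} (suc a) (suc b) (suc c) ij iw jw h
      with a≢b , h′  ← Equivalence.to (T-∧ {not (a ≡ᵇ b)}) h
      with a≢c , b≢c ← Equivalence.to (T-∧ {not (a ≡ᵇ c)}) h′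
      with a<k , i≢j , ij≡ ← R .known ij
         | b<k , i≢w , iw≡ ← R .known iw
         | c<k , j≢w , jw≡ ← R .known jw
      = gallai (i , j , w , (i≢j , i≢w , j≢w)
        , apart ij≡ iw≡ (differ a<k b<k (≡ᵇ-false⇒≢ a b a≢b))
        , apart ij≡ jw≡ (differ a<k c<k (≡ᵇ-false⇒≢ a c a≢c))
        , apart iw≡ jw≡ (differ b<k c<k (≡ᵇ-false⇒≢ b c b≢c)))
      where
      apart : ∀ {x y x′ y′ : Fin t} → x ≡ x′ → y ≡ y′ → x′ ≢ y′ → x ≢ y
      apart refl refl x≢y = x≢y

    rainbowAt-sound : ∀ i j → ¬ T (rainbowAt M i j)
    rainbowAt-sound i j h
      with g , _ , holds ← select 1 (rainbow (entry M i j)) (zip (row M i) (row M j)) h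
      = rainbow-sound _ _ _ refl refl refl
          (subst (T ∘ rainbow (entry M i j)) (lookup-zip (g zero) (row M i) (row M j)) (holds zero))

    -- If some entry is `suc b`, then `known` supplies `b < k` and `thirdSide` the other edge of the
    -- page. `bookOn` also tries `b = k`, a name no edge bears yet; it detects monochromatic books
    -- even while only one colour is named.
    page-sound : ∀ {u v w} a b p q → u ≢ v → a < k → colour f u v ≡ ρ a → a ≢ b →
      entry M u w ≡ p → entry M v w ≡ q → T (page (suc a) (suc b) (p , q)) →
      (u ≢ w × v ≢ w) × (colour f u w ∈ ⁅ ρ a ⁆ ∪ ⁅ ρ b ⁆ × colour f v w ∈ ⁅ ρ a ⁆ ∪ ⁅ ρ b ⁆)
    page-sound {u} {v} {w} a b p q u≢v a<k uv≡ a≢b uw vw h =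
      [ fromOneSide u≢v uv≡ ∘ code uw b
      , [ swap ∘ fromOneSide (≢-sym u≢v) (trans (colour-sym f v u) uv≡) ∘ code vw b , bothSpine ]′
        ∘ Equivalence.to (T-∨ {q ≡ᵇ suc b})
      ]′ (Equivalence.to (T-∨ {p ≡ᵇ suc b}) h)
      where
      S = ⁅ ρ a ⁆ ∪ ⁅ ρ b ⁆

      code : ∀ {x y : Fin n} {r} → entry M x y ≡ r → ∀ c → T (r ≡ᵇ suc c) → entry M x y ≡ suc c
      code {r = r} eq c h = trans eq (ℕ.≡ᵇ⇒≡ r (suc c) h)

      a∈S : ∀ {c} → c ≡ ρ a → c ∈ S
      a∈S refl = x∈p∪q⁺ (inj₁ (x∈⁅x⁆ _))

      b∈S : ∀ {c} → c ≡ ρ b → c ∈ S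
      b∈S refl = x∈p∪q⁺ (inj₂ (x∈⁅x⁆ _))

      fromOneSide : ∀ {x y} → x ≢ y → colour f x y ≡ ρ a → entry M x w ≡ suc b →
        (x ≢ w × y ≢ w) × (colour f x w ∈ S × colour f y w ∈ S)
      fromOneSide x≢y xy≡ xw
        with b<k , x≢w , xw≡ ← R .known xw
        with y≢w , yw ← thirdSide x≢y x≢w
               (λ eq → differ a<k b<k a≢b (trans (sym xy≡) (trans eq xw≡)))
        = (x≢w , y≢w)
        , b∈S xw≡ , [ (λ eq → a∈S (trans eq xy≡)) , (λ eq → b∈S (trans eq xw≡)) ]′ yw

      swap : (v ≢ w × u ≢ w) × (colour f v w ∈ S × colour f u w ∈ S) →
             (u ≢ w × v ≢ w) × (colour f u w ∈ S × colour f v w ∈ S)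
      swap ((v≢w , u≢w) , vw∈S , uw∈S) = (u≢w , v≢w) , uw∈S , vw∈S

      bothSpine : T ((p ≡ᵇ suc a) ∧ (q ≡ᵇ suc a)) →
        (u ≢ w × v ≢ w) × (colour f u w ∈ S × colour f v w ∈ S)
      bothSpine h
        with ha , hb ← Equivalence.to (T-∧ {p ≡ᵇ suc a}) h
        with _ , u≢w , uw≡ ← R .known (code uw a ha)
           | _ , v≢w , vw≡ ← R .known (code vw a hb)
        = (u≢w , v≢w) , a∈S uw≡ , a∈S vw≡

    bookOn-sound : ∀ {u v} c a → entry M u v ≡ a → T (bookOn k c a (zip (row M u) (row M v))) →
      CopyUsing 2 (Book 4) f
    bookOn-sound {u} {v} c (suc a) uv h
      with b , hb ← Any.satisfied (Any.any⁻ (λ b → not (a ≡ᵇ b) ∧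
             atLeast 4 (page (suc a) (suc b)) (zip (row M u) (row M v)))
             (if a ≡ᵇ c then upTo (suc k) else c ∷ []) h)
      with a≢b , four ← Equivalence.to (T-∧ {not (a ≡ᵇ b)}) hb
      with a<k , u≢v , uv≡ ← R .known uv
      with g , inj , holds ← select 4 (page (suc a) (suc b)) (zip (row M u) (row M v)) four
      = bookCopy f (ρ a) (ρ b) u≢v uv≡ (g , inj , λ i →
          page-sound a b _ _ u≢v a<k uv≡ (≡ᵇ-false⇒≢ a b a≢b) refl refl
            (subst (T ∘ page (suc a) (suc b)) (lookup-zip (g i) (row M u) (row M v)) (holds i)))

    bookFrom-sound : ∀ c u → T (bookFrom k c M (row M u)) → CopyUsing 2 (Book 4) f
    bookFrom-sound c u h
      with g , _ , holds ← select 1 (λ (a , s) → bookOn k c a (zip (row M u) s))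
                                  (zip (row M u) M) h
      = bookOn-sound c _ refl (subst (λ (a , s) → T (bookOn k c a (zip (row M u) s)))
          (lookup-zip (g zero) (row M u) M) (holds zero))

    bookTest-sound : ∀ i j → T (bookTest k M i j) → CopyUsing 2 (Book 4) f
    bookTest-sound i j h =
      [ bookFrom-sound c i , bookFrom-sound c j ]′
      (Equivalence.to (T-∨ {bookFrom k c M (row M i)}) h)
      where c = pred (entry M i j)

    clawOn-sound : ∀ u c → T (clawOn c (row M u)) → Claw f
    clawOn-sound u (suc a) h
      with g , inj , holds ← select 3 (_≡ᵇ suc a) (row M u) h
      = u Fun.∷ g , ∷-injective (proj₁ ∘ proj₂ ∘ edge) inj , ρ a , proj₂ ∘ proj₂ ∘ edge
      where
      edge : ∀ i → a < k × u ≢ g i × colour f u (g i) ≡ ρ a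
      edge i = R .known (ℕ.≡ᵇ⇒≡ _ (suc a) (holds i))

    clawTest-sound : ∀ i j → T (clawTest k M i j) → Claw f
    clawTest-sound i j h =
      [ clawOn-sound i (entry M i j) , clawOn-sound j (entry M i j) ]′
      (Equivalence.to (T-∨ {clawOn (entry M i j) (row M i)}) h)

  module _ {P : Set} (fresh : ℕ → Bool) (fresh-ok : ∀ {k} → k < t → T (fresh k))
    (test : Test n)
    (test-sound : ∀ {ρ k M} → Represents ρ k M → ∀ i j → T (test k M i j) → P) where

    mutual
      -- The colouring `f` itself picks the branch to follow: the colour of `ij` either has a name
      -- below `k` or receives the name `k`.
      unavoidable-sound : ∀ es → All (λ (i , j) → i ≢ j) es → ∀ {ρ k M} → Represents ρ k M →
        T (unavoidable fresh test es k M) → P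
      unavoidable-sound ((i , j) ∷ es) (i≢j ∷ es≢) {ρ} {k} {M} R h
        with old , new ← Equivalence.to (T-∧ {all (λ m →
               afterPainting fresh test es i j k (paint m i j M)) (upTo k)}) h
        with ℕ.anyUpTo? (λ m → ρ m ≟ colour f i j) k
      ... | yes (m , m<k , ρm≡) =
        afterPainting-sound es es≢ i j (paint-represents i≢j m<k (sym ρm≡) R)
          (All.applyUpTo⁻ id k (All.all⁺ _ (upTo k) old) m<k)
      ... | no unseen with Equivalence.to (T-∨ {not (fresh k)}) new
      -- With the new colour there are `suc k` distinct colours, whence `k < t` and `fresh k` holds.
      ...   | inj₁ stale = ⊥-elim (subst T (Equivalence.to T-not-≡ stale)
                (fresh-ok (represents-≤ (name-colour (colour f i j) (λ m<k eq → unseen (_ , m<k , eq)) R))))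
      ...   | inj₂ h′ = afterPainting-sound es es≢ i j
                (paint-represents i≢j (ℕ.n<1+n k) (sym (↦-at ρ k _))
                  (name-colour (colour f i j) (λ m<k eq → unseen (_ , m<k , eq)) R)) h′

      afterPainting-sound : ∀ es → All (λ (i , j) → i ≢ j) es → ∀ i j {ρ k M} → Represents ρ k M →
        T (afterPainting fresh test es i j k M) → P
      afterPainting-sound es es≢ i j {ρ} {k} {M} R h
        with Equivalence.to (T-∨ {rainbowAt M i j}) h
      ... | inj₁ rainbow = contradiction rainbow (rainbowAt-sound R i j)
      ... | inj₂ h′ with Equivalence.to (T-∨ {test k M i j}) h′
      ...   | inj₁ found = test-sound R i j found
      ...   | inj₂ rest  = unavoidable-sound es es≢ R rest

    unavoidable⇒ : ∀ es → All (λ (i , j) → i ≢ j) es → ∀ {ρ k M} → Represents ρ k M →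
      unavoidable fresh test es k M ≡ true → P
    unavoidable⇒ es es≢ R h = unavoidable-sound es es≢ R (Equivalence.from T-≡ h)

-- Monochromatic stars in Gallai colourings of K₆.

-- Each vertex is joined to all earlier ones before the next is taken up, so triangles close early
-- and branches die soon.
edgesFrom : ∀ {A : Set} → List A → List A → List (A × A)
edgesFrom seen []       = []
edgesFrom seen (x ∷ xs) = List.map (_, x) seen ++ edgesFrom (seen ∷ʳ x) xs

edges₆ : List (Fin 6 × Fin 6)
edges₆ = edgesFrom [] (List.allFin 6)

-- With `const true` the number of colours is unbounded, so one search serves every `t`.
clawUnavoidable : unavoidable (const true) clawTest edges₆ 0 blank ≡ true
clawUnavoidable = refl

-- Abstract, since unfolding it during conversion would replay the search.
abstract
  GallaiK₆⇒Claw : ∀ {t} (f : Colouring 6 (suc t)) → Gallai f → Claw f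
  GallaiK₆⇒Claw f gallai = unavoidable⇒ f gallai (const true) _ clawTest
    (clawTest-sound f gallai) edges₆ (from-yes (All.all? (λ (i , j) → ¬? (i ≟ j)) edges₆))
    {ρ = const zero} {k = 0} (blank-represents f gallai λ ()) clawUnavoidable

-- Upper bounds: the search for a book, starting from a star.

centre : ∀ d → Fin (d + 4)
centre d = d ↑ʳ zero

leaf : ∀ d → Fin 3 → Fin (d + 4)
leaf d i = d ↑ʳ suc i

clawMatrix : ∀ d → Matrix (d + 4)
clawMatrix d = paint 0 (centre d) (leaf d (# 0)) (paint 0 (centre d) (leaf d (# 1))
  (paint 0 (centre d) (leaf d (# 2)) blank))

edgesOffClaw : ∀ d → List (Fin (d + 4) × Fin (d + 4))
edgesOffClaw d = edgesFrom [] (List.map (leaf d) (List.allFin 3)) ++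
  edgesFrom (List.map (d ↑ʳ_) (List.allFin 4)) (List.map (_↑ˡ 4) (List.allFin d))

-- By `2 ≤ d` there are six vertices to which the result on K₆ applies. The star found there is
-- moved to the last four indices, the place where `extendInjection` leaves it.
clawAtEnd : ∀ {t} d → 2 ≤ d → (f : Colouring (d + 4) (suc t)) → Gallai f →
  Σ[ σ ∈ (Fin (d + 4) → Fin (d + 4)) ] Injective _≡_ _≡_ σ ×
    (∃[ a ] ∀ l → colour f (σ (centre d)) (σ (leaf d l)) ≡ a)
clawAtEnd d 2≤d f gallai =
  let g , g-inj , a , claw  = GallaiK₆⇒Claw (relabel embed f) (relabel-Gallai embed-inj f gallai)
      σ , σ-inj , σ-extends = extendInjection d (embed ∘ g) (g-inj ∘ embed-inj) ℕ.≤-refl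
  in σ , σ-inj , a , λ l → trans (cong₂ (colour f) (σ-extends zero) (σ-extends (suc l))) (claw l)
  where
  embed : Fin 6 → Fin (d + 4)
  embed i = inject≤ i (ℕ.+-monoˡ-≤ 4 2≤d)

  embed-inj : Injective _≡_ _≡_ embed
  embed-inj = inject≤-injective _ _ _ _

clawMatrix-represents : ∀ {t} d (f : Colouring (d + 4) t) (gallai : Gallai f) a →
  (∀ l → colour f (centre d) (leaf d l) ≡ a) → Represents f gallai (const a) 1 (clawMatrix d)
-- Only the name 0 is in use, so the constant map is injective on names.
clawMatrix-represents d f gallai a claw = spoke (# 0) (spoke (# 1) (spoke (# 2)
  (blank-represents f gallai λ { z<s z<s _ → refl })))
  where
  spoke : ∀ {M} l → Represents f gallai (const a) 1 M →
    Represents f gallai (const a) 1 (paint 0 (centre d) (leaf d l) M)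
  spoke l = paint-represents f gallai (0≢1+n ∘ ↑ʳ-injective d _ _) (ℕ.n<1+n 0) (claw l)

forcesBook : ∀ {t} d (fresh : ℕ → Bool) → (∀ {k} → k < suc t → T (fresh k)) → 2 ≤ d →
  All (λ (i , j) → i ≢ j) (edgesOffClaw d) →
  unavoidable fresh bookTest (edgesOffClaw d) 1 (clawMatrix d) ≡ true →
  Forces (suc t) 2 (Book 4) (d + 4)
forcesBook d fresh fresh-ok 2≤d proper h f gallai =
  let σ , σ-inj , a , claw = clawAtEnd d 2≤d f gallai
      gallai′              = relabel-Gallai σ-inj f gallai
  in relabel-copy σ-inj f (unavoidable⇒ (relabel σ f) gallai′ fresh fresh-ok bookTest
       (bookTest-sound (relabel σ f) gallai′) (edgesOffClaw d) proper
       (clawMatrix-represents d (relabel σ f) gallai′ a claw) h)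

-- `_<ᵇ 3` admits a new colour only while fewer than three are named. On eight vertices no such
-- bound is imposed, and a single search covers all `t`.
searchK₇ : unavoidable (_<ᵇ 3) bookTest (edgesOffClaw 3) 1 (clawMatrix 3) ≡ true
searchK₇ = refl

searchK₈ : unavoidable (const true) bookTest (edgesOffClaw 4) 1 (clawMatrix 4) ≡ true
searchK₈ = refl

forces₇ : Forces 3 2 (Book 4) 7
forces₇ = forcesBook 3 (_<ᵇ 3) ℕ.<⇒<ᵇ (s≤s (s≤s z≤n))
  (from-yes (All.all? (λ (i , j) → ¬? (i ≟ j)) (edgesOffClaw 3))) searchK₇

forces₈ : ∀ t → Forces (suc t) 2 (Book 4) 8
forces₈ t = forcesBook 4 (const true) _ (s≤s (s≤s z≤n))
  (from-yes (All.all? (λ (i , j) → ¬? (i ≟ j)) (edgesOffClaw 4))) searchK₈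

-- Lower bounds: colourings without a two-coloured B₄.

PageOf : ∀ {n t} → Colouring n t → Subset t → (u v w : Fin n) → Set
PageOf f S u v w = u ≢ w × v ≢ w × colour f u w ∈ S × colour f v w ∈ S

-- Copies of the book spelled out by quantifiers over finite sets, hence decidable by evaluation.
-- Each condition stands right after the vertices it concerns, to cut the enumeration short.
TwoColouredB₄ : ∀ {n t} → Colouring n t → Set
TwoColouredB₄ f = ∃[ S ] ∣ S ∣ ≤ 2 × ∃[ u ] ∃[ v ] u ≢ v × colour f u v ∈ S ×
  ∃[ p ] PageOf f S u v p ×
  ∃[ q ] p ≢ q × PageOf f S u v q ×
  ∃[ r ] p ≢ r × q ≢ r × PageOf f S u v r ×
  ∃[ s ] p ≢ s × q ≢ s × r ≢ s × PageOf f S u v s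

_≢?_ : ∀ {n} (i j : Fin n) → Dec (i ≢ j)
i ≢? j = ¬? (i ≟ j)

pageOf? : ∀ {n t} (f : Colouring n t) S u v w → Dec (PageOf f S u v w)
pageOf? f S u v w =
  u ≢? w ×-dec v ≢? w ×-dec colour f u w ∈? S ×-dec colour f v w ∈? S

twoColouredB₄? : ∀ {n t} (f : Colouring n t) → Dec (TwoColouredB₄ f)
twoColouredB₄? f = anySubset? λ S → ∣ S ∣ ≤? 2 ×-dec
  any? λ u → any? λ v → u ≢? v ×-dec colour f u v ∈? S ×-dec
  any? λ p → pageOf? f S u v p ×-dec
  any? λ q → p ≢? q ×-dec pageOf? f S u v q ×-dec
  any? λ r → p ≢? r ×-dec q ≢? r ×-dec pageOf? f S u v r ×-dec
  any? λ s → p ≢? s ×-dec q ≢? s ×-dec r ≢? s ×-dec pageOf? f S u v s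

rainbowTriangle? : ∀ {n t} (f : Colouring n t) → Dec (RainbowTriangle f)
rainbowTriangle? f = any? λ x → any? λ y → any? λ z →
  (x ≢? y ×-dec x ≢? z ×-dec y ≢? z) ×-dec
  (colour f x y ≢? colour f x z ×-dec colour f x y ≢? colour f y z ×-dec
   colour f x z ≢? colour f y z)

moreColours : ∀ {n t} m → Colouring n t → Colouring n (t + m)
moreColours m f = record
  { colour     = λ u v → colour f u v ↑ˡ m
  ; colour-sym = λ u v → cong (_↑ˡ m) (colour-sym f u v)
  }

∣take∣≤ : ∀ t {m} (S : Subset (t + m)) → ∣ Vec.take t S ∣ ≤ ∣ S ∣
∣take∣≤ zero    S             = z≤n
∣take∣≤ (suc t) (inside  ∷ S) = s≤s (∣take∣≤ t S)
∣take∣≤ (suc t) (outside ∷ S) = ∣take∣≤ t S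

∈-take : ∀ {t m} {i : Fin t} {S : Subset (t + m)} → i ↑ˡ m ∈ S → i ∈ Vec.take t S
∈-take {i = zero}  here        = here
∈-take {i = suc i} (there i∈S) = there (∈-take i∈S)

notForced : ∀ {n t} (f : Colouring n t) → Gallai f → ¬ TwoColouredB₄ f →
  ∀ m → ¬ Forces (t + m) 2 (Book 4) n
notForced {n} {t} f gallai noBook m forces = noBook (book (forces (moreColours m f) gallai′))
  where
  gallai′ : Gallai (moreColours m f)
  gallai′ (x , y , z , xyz , (a , b , c)) =
    gallai (x , y , z , xyz , (a ∘ cong (_↑ˡ m) , b ∘ cong (_↑ˡ m) , c ∘ cong (_↑ˡ m)))

  book : CopyUsing 2 (Book 4) (moreColours m f) → TwoColouredB₄ f
  book (φ , S , S≤2 , uses) =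
    Vec.take t S , ℕ.≤-trans (∣take∣≤ t S) S≤2
    , spine (# 0) , spine (# 1) , apart (λ ()) , ∈-take (uses {inj₁ (# 0)} {inj₁ (# 1)} λ ())
    , pages (# 0) , isPage (# 0)
    , pages (# 1) , apart (λ ()) , isPage (# 1)
    , pages (# 2) , apart (λ ()) , apart (λ ()) , isPage (# 2)
    , pages (# 3) , apart (λ ()) , apart (λ ()) , apart (λ ()) , isPage (# 3)
    where
    spine : Fin 2 → Fin n
    spine i = map φ (inj₁ i)

    pages : Fin 4 → Fin n
    pages i = map φ (inj₂ (i , zero))

    apart : ∀ {x y} → x ≢ y → map φ x ≢ map φ y
    apart x≢y = x≢y ∘ injective φ

    isPage : ∀ i → PageOf f (Vec.take t S) (spine (# 0)) (spine (# 1)) (pages i)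
    isPage i = apart (λ ()) , apart (λ ())
      , ∈-take (uses {inj₁ (# 0)} {inj₂ (i , zero)} tt)
      , ∈-take (uses {inj₁ (# 1)} {inj₂ (i , zero)} tt)

-- B₄ spans all six vertices, so both spine ends would have to miss a common colour. But colour 2 is
-- missed only by vertex 0, colour 1 only by vertex 3, and colour 0 by none. The zeros on the
-- diagonal are placeholders.
twoTriangles : Colouring 6 3
twoTriangles = record
  { colour     = λ u v → lookup (lookup colours u) v
  ; colour-sym = from-yes (all? λ u → all? λ v →
      lookup (lookup colours u) v ≟ lookup (lookup colours v) u)
  }
  where
  colours : Vec (Vec (Fin 3) 6) 6
  colours =
    (# 0 ∷ # 1 ∷ # 1 ∷ # 0 ∷ # 0 ∷ # 0 ∷ []) ∷
    (# 1 ∷ # 0 ∷ # 2 ∷ # 0 ∷ # 0 ∷ # 0 ∷ []) ∷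
    (# 1 ∷ # 2 ∷ # 0 ∷ # 0 ∷ # 0 ∷ # 0 ∷ []) ∷
    (# 0 ∷ # 0 ∷ # 0 ∷ # 0 ∷ # 2 ∷ # 2 ∷ []) ∷
    (# 0 ∷ # 0 ∷ # 0 ∷ # 2 ∷ # 0 ∷ # 1 ∷ []) ∷
    (# 0 ∷ # 0 ∷ # 0 ∷ # 2 ∷ # 1 ∷ # 0 ∷ []) ∷ []

cone : ∀ {n t} → Colouring n t → Colouring (suc n) (suc t)
cone {n} {t} f = record { colour = c ; colour-sym = c-sym }
  where
  c : Fin (suc n) → Fin (suc n) → Fin (suc t)
  c zero    _       = zero
  c (suc _) zero    = zero
  c (suc u) (suc v) = suc (colour f u v)

  c-sym : ∀ u v → c u v ≡ c v u
  c-sym zero    zero    = refl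
  c-sym zero    (suc _) = refl
  c-sym (suc _) zero    = refl
  c-sym (suc u) (suc v) = cong suc (colour-sym f u v)

notForced₆ : ¬ Forces 3 2 (Book 4) 6
notForced₆ = notForced twoTriangles
  (from-no (rainbowTriangle? twoTriangles)) (from-no (twoColouredB₄? twoTriangles)) 0

-- Decided by evaluation. The reason: a two-coloured B₄ through the apex leaves a single colour for
-- its edges off the apex, hence a monochromatic K₁,₄ (apex on the spine) or triangle (apex a page)
-- in `twoTriangles`. Its colour classes have maximum degree 3 and no triangles.
notForced₇ : ∀ m → ¬ Forces (4 + m) 2 (Book 4) 7
notForced₇ = notForced (cone twoTriangles)
  (from-no (rainbowTriangle? (cone twoTriangles))) (from-no (twoColouredB₄? (cone twoTriangles)))

-- The values of the weakened Gallai-Ramsey number.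

-- Forcing is monotone in the order, so failure at `p` excludes every `q ≤ p`.
isGR : ∀ {t s G p} → Forces t s G (suc p) → ¬ Forces t s G p → IsGR t s G (suc p)
isGR forces not = forces , λ q forces-q →
  ℕ.≰⇒> λ q≤p → not (Forces-mono q≤p forces-q)

theorem3p2 : (t : ℕ) → t ≥ 3 →
    (t ≡ 3 → IsGR t 2 (Book 4) 7) × (t ≥ 4 → IsGR t 2 (Book 4) 8)
theorem3p2 t _ = (λ { refl → isGR forces₇ notForced₆ }) , λ t≥4 → atLeast4 (ℕ.m≤n⇒∃[o]m+o≡n t≥4)
  where
  atLeast4 : ∃[ m ] 4 + m ≡ t → IsGR t 2 (Book 4) 8
  atLeast4 (m , refl) = isGR (forces₈ (3 + m)) (notForced₇ m)
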